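{- Let $m\ge 2$ be an integer and let $\Lambda$ be a subset of $I_2[m]$ with $|\Lambda|=r$. Then $$K_\Lambda=\tfrac12\Sigma(G_\Lambda)-r,\quad\text{or equivalently,}\quad \Sigma(G_\Lambda)=2K_\Lambda+2r.$$ Consequently, $\Lambda$ is a subclose family if and only if $G_\Lambda$ is an optimal graph. Moreover, $$\max\{\Sigma(G) : G \text{ is a simple } (m,r)\text{ -graph}\}=2K_r(2,m)+2r.$$
   Context: $[m]:=\{1,\dots,m\}$, and $I_2[m]$ denotes the set of all $2$-element subsets of $[m]$. For $\Lambda=\{A_1,\dots,A_r\}\subseteq I_2[m]$ with $|\Lambda|=r$ (the $A_i$ distinct), put $K_\Lambda:=\sum_{1\le i<j\le r}|A_i\cap A_j|$. For an integer $0\le r\le\binom{m}{2}$, put $K_r(2,m):=\max\{K_\Lambda : \Lambda\subseteq I_2[m],\ |\Lambda|=r\}$. A family $\Lambda\subseteq I_2[m]$ is called subclose if $K_\Lambda=K_r(2,m)$, where $r=|\Lambda|$. $G_\Lambda$ denotes the simple undirected graph with vertex set $[m]$ and edge set $\Lambda$. An $(m,r)$-graph is a graph with vertex set $[m]$ and exactly $r$ edges. For a simple $(m,r)$-graph $G$, $g_i(G)$ is the degree of vertex $i$ and $\Sigma(G):=\sum_{i=1}^m g_i(G)^2$. A simple $(m,r)$-graph $G$ is called optimal if $\Sigma(G)$ is maximum among all simple $(m,r)$-graphs. -}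

module Defs where

open import Data.Fin.Subset using (Subset; ∣_∣; _∩_)
open import Data.Fin.Subset.Properties using (_∈?_)
open import Data.Integer.Base using (+_)
open import Data.List.Base using (List; []; _∷_; length; map; filter)
open import Data.List.Relation.Unary.All using (All)
open import Data.List.Relation.Unary.Unique.Propositional using (Unique)
open import Data.Nat.Base using (ℕ; _+_; _^_; _≤_)
open import Data.Nat.ListAction using () renaming (sum to sumᴸ)
open import Data.Nat.Properties using (+-0-commutativeMonoid)
open import Data.Fin.Base using (Fin)
open import Data.Product.Base using (_×_; ∃-syntax)
open import Data.Rational.Base using (ℚ; _/_)
open import Relation.Binary.PropositionalEquality.Core using (_≡_)
open import Algebra.Properties.CommutativeMonoid.Sum +-0-commutativeMonoid
  using (sum; sum-syntax)

-- A set Λ ⊆ I₂[m] is given by listing its elements A₁, …, Aᵣ without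
-- repetition; [m] is Fin m.  Nothing below depends on the order of the list.
record Family (m : ℕ) : Set where
  field
    members  : List (Subset m)
    distinct : Unique members
    pairs    : All (λ A → ∣ A ∣ ≡ 2) members

  size : ℕ
  size = length members

-- ∑_{i<j} |Aᵢ ∩ Aⱼ|: the head is intersected with every later entry.
intersections : ∀ {m} → List (Subset m) → ℕ
intersections []       = 0
intersections (A ∷ As) = sumᴸ (map (λ B → ∣ A ∩ B ∣) As) + intersections As

K : ∀ {m} → Family m → ℕ
K Λ = intersections (Family.members Λ)

-- n = max { f x : P x }; in particular the maximum is attained.
IsMax : {A : Set} → (A → Set) → (A → ℕ) → ℕ → Set
IsMax P f n = (∃[ x ] P x × f x ≡ n) × (∀ x → P x → f x ≤ n)

-- k = K_r(2,m)
IsKᵣ : (m r k : ℕ) → Set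
IsKᵣ m r = IsMax (λ (Λ : Family m) → Family.size Λ ≡ r) K

Subclose : ∀ {m} → Family m → Set
Subclose {m} Λ = IsKᵣ m (Family.size Λ) (K Λ)

-- A simple undirected graph with vertex set [m]: its edges are distinct
-- 2-element sets of vertices.
record SimpleGraph (m : ℕ) : Set where
  constructor graph
  field
    edgeSet : Family m

  edges : List (Subset m)
  edges = Family.members edgeSet

  edgeCount : ℕ
  edgeCount = Family.size edgeSet

  degree : Fin m → ℕ
  degree i = length (filter (i ∈?_) edges)

G⟨_⟩ : ∀ {m} → Family m → SimpleGraph m
G⟨ Λ ⟩ = graph Λ

Σdeg² : ∀ {m} → SimpleGraph m → ℕ
Σdeg² {m} G = ∑[ i < m ] (SimpleGraph.degree G i ^ 2)

-- s = max { Σ(G) : G a simple (m,r)-graph }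
IsMaxΣdeg² : (m r s : ℕ) → Set
IsMaxΣdeg² m r = IsMax (λ (G : SimpleGraph m) → SimpleGraph.edgeCount G ≡ r) Σdeg²

Optimal : ∀ {m} → SimpleGraph m → Set
Optimal {m} G = IsMaxΣdeg² m (SimpleGraph.edgeCount G) (Σdeg² G)

toℚ : ℕ → ℚ
toℚ n = + n / 1

{-# OPTIONS --safe #-}

-- Count incidences: the indicator functions χ A of the edges satisfy
-- deg i = ∑_A χ A i and |A ∩ B| = ∑_i χ A i χ B i, so expanding the square
-- gives ∑_i (deg i)² = ∑_A |A| + 2 ∑_{A<B} |A ∩ B|, where |A| = 2.
-- The maxima are attained because there are only finitely many families.
module Submission where

open import Defs
open import Data.Bool.Base using (true; false; if_then_else_; _∧_)
open import Data.Bool.Properties using () renaming (_≟_ to _≟ᵇ_)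
open import Data.Fin.Base using (Fin)
open import Data.Fin.Subset using (Subset; ∣_∣; _∩_)
open import Data.Fin.Subset.Properties using (_∈?_)
open import Data.Integer.Base using () renaming (+_ to pos; _+_ to _+ℤ_; _*_ to _*ℤ_)
import Data.Integer.Properties as ℤ
open import Data.List.Base using (List; []; _∷_; length; map; filter; cartesianProductWith)
open import Data.List.Extrema.Nat using (argmax; argmax-all; f[xs]≤f[argmax])
open import Data.List.Membership.Propositional using (_∈_)
open import Data.List.Membership.Propositional.Properties
  using (∈-cartesianProductWith⁺; ∈-filter⁺)
open import Data.List.Properties using (filter-accept; filter-reject)
open import Data.List.Relation.Unary.All as All using (All; []; _∷_)
open import Data.List.Relation.Unary.All.Properties using (all-filter)
open import Data.List.Relation.Unary.AllPairs using (allPairs?)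
open import Data.List.Relation.Unary.Any using (here; there)
open import Data.List.Relation.Unary.Unique.Propositional using (Unique)
open import Data.Nat.Base using (ℕ; zero; suc; _+_; _*_; _^_; _≤_)
open import Data.Nat.ListAction using () renaming (sum to sumᴸ)
open import Data.Nat.Properties
  using (+-*-semiring; +-identityʳ; +-monoˡ-≤; +-cancelʳ-≤; +-cancelʳ-≡; *-monoʳ-≤; *-cancelˡ-≤;
         *-cancelˡ-≡; *-zeroʳ; _≟_)
open import Algebra.Properties.Semiring.Sum +-*-semiring
  using (sum-syntax; sum-cong-≗; sum-replicate-zero; ∑-distrib-+; *-distribˡ-sum)
open import Data.Nat.Tactic.RingSolver using (solve-∀)
open import Data.Product.Base using (_×_; _,_; ∃-syntax; ∃₂; proj₁; proj₂)
open import Data.Rational.Base using (½; 1ℚ; toℚᵘ)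
  renaming (_+_ to _+ℚ_; _*_ to _*ℚ_; _-_ to _-ℚ_; -_ to -ℚ_)
import Data.Rational.Properties as ℚ
open import Data.Rational.Unnormalised.Base using (mkℚᵘ; *≡*)
  renaming (_+_ to _+ᵘ_)
import Data.Rational.Unnormalised.Properties as ℚᵘ
open import Data.Vec.Base using (Vec; []; _∷_; lookup; toList; fromList)
open import Data.Vec.Properties
  using ([]=⇒lookup; lookup⇒[]=; lookup-zipWith; length-toList; toList∘fromList; ≡-dec)
open import Function.Bundles using (_⇔_; mk⇔; Equivalence)
open import Relation.Binary.PropositionalEquality.Core
  using (_≡_; refl; sym; trans; cong; cong₂; subst)
open import Relation.Binary.PropositionalEquality.Properties using (module ≡-Reasoning)
open import Relation.Nullary.Decidable using (¬?; _×-dec_)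
open import Relation.Nullary.Negation using (contradiction)
open import Relation.Unary using (Decidable)

private
  variable
    A : Set
    m n : ℕ

-- Degrees and intersections through indicator functions

χ : Subset m → Fin m → ℕ
χ p i = if lookup p i then 1 else 0

deg : List (Subset m) → Fin m → ℕ
deg ps i = length (filter (i ∈?_) ps)

deg-∷ : (p : Subset m) (ps : List (Subset m)) (i : Fin m) →
        deg (p ∷ ps) i ≡ χ p i + deg ps i
deg-∷ p ps i with lookup p i in eq
... | true  = cong length (filter-accept (i ∈?_) (lookup⇒[]= i p eq))
... | false = cong length (filter-reject (i ∈?_) λ i∈p →
                contradiction (trans (sym eq) ([]=⇒lookup i∈p)) λ ())

∑χ≡∣p∣ : (p : Subset m) → ∑[ i < m ] χ p i ≡ ∣ p ∣
∑χ≡∣p∣ []          = refl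
∑χ≡∣p∣ (true ∷ p)  = cong suc (∑χ≡∣p∣ p)
∑χ≡∣p∣ (false ∷ p) = ∑χ≡∣p∣ p

χ-∩ : (p q : Subset m) (i : Fin m) → χ (p ∩ q) i ≡ χ p i * χ q i
χ-∩ p q i rewrite lookup-zipWith _∧_ i p q with lookup p i
... | true  = sym (+-identityʳ _)
... | false = refl

χ-idem : (p : Subset m) (i : Fin m) → χ p i * χ p i ≡ χ p i
χ-idem p i with lookup p i
... | true  = refl
... | false = refl

-- Double counting: both sides count the pairs of an entry `q` of `ps` and a vertex in `p ∩ q`, the
-- left one vertex by vertex and the right one entry by entry.
∑χ*deg : (p : Subset m) (ps : List (Subset m)) →
         ∑[ i < m ] (χ p i * deg ps i) ≡ sumᴸ (map (λ q → ∣ p ∩ q ∣) ps)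
∑χ*deg {m} p [] =
  trans (sum-cong-≗ (λ i → *-zeroʳ (χ p i))) (sum-replicate-zero m)
∑χ*deg {m} p (q ∷ ps) = begin
  ∑[ i < m ] (χ p i * deg (q ∷ ps) i)
    ≡⟨ sum-cong-≗ (λ i → trans (cong (χ p i *_) (deg-∷ q ps i))
                        (trans (expand (χ p i) (χ q i) (deg ps i))
                               (cong (_+ χ p i * deg ps i) (sym (χ-∩ p q i))))) ⟩
  ∑[ i < m ] (χ (p ∩ q) i + χ p i * deg ps i)
    ≡⟨ ∑-distrib-+ (χ (p ∩ q)) (λ i → χ p i * deg ps i) ⟩
  ∑[ i < m ] χ (p ∩ q) i + ∑[ i < m ] (χ p i * deg ps i)
    ≡⟨ cong₂ _+_ (∑χ≡∣p∣ (p ∩ q)) (∑χ*deg p ps) ⟩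
  ∣ p ∩ q ∣ + sumᴸ (map (λ q → ∣ p ∩ q ∣) ps) ∎
  where
  open ≡-Reasoning
  expand : ∀ a b c → a * (b + c) ≡ a * b + a * c
  expand = solve-∀

-- Induction on the list: a new edge `p` adds `χ p i` to the degree of `i`. In the expanded square,
-- `χ p i * χ p i` is `χ p i` again and sums to `∣ p ∣`, which is 2; the cross terms sum to twice
-- the intersections of `p` with the later entries, which is twice what `intersections` gains.
∑deg² : (ps : List (Subset m)) → All (λ p → ∣ p ∣ ≡ 2) ps →
        ∑[ i < m ] (deg ps i ^ 2) ≡ 2 * intersections ps + 2 * length ps
∑deg² {m} [] [] = sum-replicate-zero m
∑deg² {m} (p ∷ ps) (∣p∣≡2 ∷ pairs) = begin
  ∑[ i < m ] (deg (p ∷ ps) i ^ 2)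
    ≡⟨ sum-cong-≗ (λ i → trans (cong (_^ 2) (deg-∷ p ps i))
                        (trans (square (χ p i) (deg ps i))
                               (cong (_+ (2 * (χ p i * deg ps i) + deg ps i ^ 2)) (χ-idem p i)))) ⟩
  ∑[ i < m ] (χ p i + (2 * (χ p i * deg ps i) + deg ps i ^ 2))
    ≡⟨ ∑-distrib-+ (χ p) (λ i → 2 * (χ p i * deg ps i) + deg ps i ^ 2) ⟩
  ∑[ i < m ] χ p i + ∑[ i < m ] (2 * (χ p i * deg ps i) + deg ps i ^ 2)
    ≡⟨ cong₂ _+_ (trans (∑χ≡∣p∣ p) ∣p∣≡2)
         (∑-distrib-+ (λ i → 2 * (χ p i * deg ps i)) (λ i → deg ps i ^ 2)) ⟩
  2 + (∑[ i < m ] (2 * (χ p i * deg ps i)) + ∑[ i < m ] (deg ps i ^ 2))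
    ≡⟨ cong (2 +_) (cong₂ _+_
         (trans (sym (*-distribˡ-sum 2 (λ i → χ p i * deg ps i))) (cong (2 *_) (∑χ*deg p ps)))
         (∑deg² ps pairs)) ⟩
  2 + (2 * s + (2 * intersections ps + 2 * length ps))
    ≡⟨ collect s (intersections ps) (length ps) ⟩
  2 * (s + intersections ps) + 2 * suc (length ps) ∎
  where
  open ≡-Reasoning
  s = sumᴸ (map (λ q → ∣ p ∩ q ∣) ps)
  square : ∀ a d → (a + d) ^ 2 ≡ a * a + (2 * (a * d) + d ^ 2)
  -- `x ^ 2` unfolds by definition to `x * (x * 1)`, and the ring solver is given the identity in
  -- this unfolded form.
  square a d = lemma a d
    where
    lemma : ∀ a d → (a + d) * ((a + d) * 1) ≡ a * a + (2 * (a * d) + d * (d * 1))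
    lemma = solve-∀
  collect : ∀ s k r → 2 + (2 * s + (2 * k + 2 * r)) ≡ 2 * (s + k) + 2 * suc r
  collect = solve-∀

Σdeg²≡2K+2r : (Λ : Family m) → Σdeg² G⟨ Λ ⟩ ≡ 2 * K Λ + 2 * Family.size Λ
Σdeg²≡2K+2r Λ = ∑deg² (Family.members Λ) (Family.pairs Λ)

-- The identity over the rationals

-- `toℚ` reduces its fraction by a gcd, which is stuck on a variable. Among unnormalised fractions
-- all denominators are 1, and the claim becomes an equation of integers.
toℚ-homo-+ : ∀ m n → toℚ (m + n) ≡ toℚ m +ℚ toℚ n
toℚ-homo-+ m n = ℚ.toℚᵘ-injective (begin
  toℚᵘ (toℚ (m + n))            ≈⟨ ℚ.toℚᵘ-fromℚᵘ (mkℚᵘ (pos (m + n)) 0) ⟩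
  mkℚᵘ (pos (m + n)) 0            ≈⟨ *≡* (cong (_*ℤ pos 1)
                                     (sym (cong₂ _+ℤ_ (ℤ.*-identityʳ (pos m)) (ℤ.*-identityʳ (pos n))))) ⟩
  mkℚᵘ (pos m) 0 +ᵘ mkℚᵘ (pos n) 0  ≈⟨ ℚᵘ.+-cong (ℚ.toℚᵘ-fromℚᵘ (mkℚᵘ (pos m) 0)) (ℚ.toℚᵘ-fromℚᵘ (mkℚᵘ (pos n) 0)) ⟨
  toℚᵘ (toℚ m) +ᵘ toℚᵘ (toℚ n)  ≈⟨ ℚ.toℚᵘ-homo-+ (toℚ m) (toℚ n) ⟨
  toℚᵘ (toℚ m +ℚ toℚ n)         ∎)
  where open ℚᵘ.≃-Reasoning

halve : ∀ k r → toℚ k ≡ (½ *ℚ toℚ (2 * k + 2 * r)) -ℚ toℚ r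
halve k r = sym (begin
  ½ *ℚ toℚ (2 * k + 2 * r) -ℚ toℚ r
    -- Doubling is written as a sum so that additivity of `toℚ` applies; later `½ +ℚ ½` computes to
    -- `1ℚ`.
    ≡⟨ cong (λ n → ½ *ℚ toℚ n -ℚ toℚ r) (double k r) ⟩
  ½ *ℚ toℚ ((k + r) + (k + r)) -ℚ toℚ r
    ≡⟨ cong (λ x → ½ *ℚ x -ℚ toℚ r) (toℚ-homo-+ (k + r) (k + r)) ⟩
  ½ *ℚ (toℚ (k + r) +ℚ toℚ (k + r)) -ℚ toℚ r
    ≡⟨ cong (_-ℚ toℚ r) (ℚ.*-distribˡ-+ ½ (toℚ (k + r)) (toℚ (k + r))) ⟩
  (½ *ℚ toℚ (k + r) +ℚ ½ *ℚ toℚ (k + r)) -ℚ toℚ r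
    ≡⟨ cong (_-ℚ toℚ r) (ℚ.*-distribʳ-+ (toℚ (k + r)) ½ ½) ⟨
  1ℚ *ℚ toℚ (k + r) -ℚ toℚ r
    ≡⟨ cong (_-ℚ toℚ r) (trans (ℚ.*-identityˡ (toℚ (k + r))) (toℚ-homo-+ k r)) ⟩
  toℚ k +ℚ toℚ r -ℚ toℚ r
    ≡⟨ ℚ.+-assoc (toℚ k) (toℚ r) (-ℚ toℚ r) ⟩
  toℚ k +ℚ (toℚ r -ℚ toℚ r)
    ≡⟨ cong (toℚ k +ℚ_) (ℚ.+-inverseʳ (toℚ r)) ⟩
  toℚ k +ℚ toℚ 0
    ≡⟨ ℚ.+-identityʳ (toℚ k) ⟩
  toℚ k ∎)
  where
  open ≡-Reasoning
  double : ∀ k r → 2 * k + 2 * r ≡ (k + r) + (k + r)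
  double = solve-∀

-- Transfer of maxima

-- Once the size is fixed at `r`, the two objectives differ by the map sending `x` to
-- `2 * x + 2 * r`. It preserves and reflects both order and equality, so attained values and upper
-- bounds carry over in both directions.
IsKᵣ⇔IsMaxΣdeg² : ∀ {m r k} → IsKᵣ m r k ⇔ IsMaxΣdeg² m r (2 * k + 2 * r)
IsKᵣ⇔IsMaxΣdeg² {m} {r} {k} = mk⇔ to from
  where
  Σdeg²≡ : (Λ : Family m) → Family.size Λ ≡ r → Σdeg² G⟨ Λ ⟩ ≡ 2 * K Λ + 2 * r
  Σdeg²≡ Λ refl = Σdeg²≡2K+2r Λ

  to : IsKᵣ m r k → IsMaxΣdeg² m r (2 * k + 2 * r)
  to ((Λ , ∣Λ∣≡r , KΛ≡k) , max) =
    (G⟨ Λ ⟩ , ∣Λ∣≡r , trans (Σdeg²≡ Λ ∣Λ∣≡r) (cong (λ x → 2 * x + 2 * r) KΛ≡k)) ,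
    λ { (graph Λ′) ∣Λ′∣≡r → subst (_≤ 2 * k + 2 * r) (sym (Σdeg²≡ Λ′ ∣Λ′∣≡r))
          (+-monoˡ-≤ (2 * r) (*-monoʳ-≤ 2 (max Λ′ ∣Λ′∣≡r))) }

  from : IsMaxΣdeg² m r (2 * k + 2 * r) → IsKᵣ m r k
  from ((graph Λ , ∣Λ∣≡r , Σ≡) , max) =
    (Λ , ∣Λ∣≡r , *-cancelˡ-≡ (K Λ) k 2
      (+-cancelʳ-≡ (2 * r) (2 * K Λ) (2 * k) (trans (sym (Σdeg²≡ Λ ∣Λ∣≡r)) Σ≡))) ,
    λ Λ′ ∣Λ′∣≡r → *-cancelˡ-≤ 2 (+-cancelʳ-≤ (2 * r) (2 * K Λ′) (2 * k)
      (subst (_≤ 2 * k + 2 * r) (Σdeg²≡ Λ′ ∣Λ′∣≡r) (max G⟨ Λ′ ⟩ ∣Λ′∣≡r)))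

-- Existence of the maximum by finite search

-- Serves twice: over the Booleans it lists the subsets of `[m]`, and over those subsets it lists
-- all candidates of length `r`.
vectors : List A → (n : ℕ) → List (Vec A n)
vectors xs zero    = [] ∷ []
vectors xs (suc n) = cartesianProductWith _∷_ xs (vectors xs n)

∈-vectors : {xs : List A} → (∀ x → x ∈ xs) → (v : Vec A n) → v ∈ vectors xs n
∈-vectors all []      = here refl
∈-vectors all (x ∷ v) = ∈-cartesianProductWith⁺ _∷_ (all x) (∈-vectors all v)

toList-surjective : (xs : List A) → length xs ≡ n → ∃[ v ] toList {n = n} v ≡ xs
toList-surjective xs refl = fromList xs , toList∘fromList xs

subsets : (m : ℕ) → List (Subset m)
subsets = vectors (true ∷ false ∷ [])

∈-subsets : (p : Subset m) → p ∈ subsets m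
∈-subsets = ∈-vectors λ { true → here refl ; false → there (here refl) }

IsFamily : List (Subset m) → Set
IsFamily ps = Unique ps × All (λ p → ∣ p ∣ ≡ 2) ps

isFamily? : Decidable (IsFamily {m})
isFamily? ps =
  allPairs? (λ p q → ¬? (≡-dec _≟ᵇ_ p q)) ps ×-dec All.all? (λ p → ∣ p ∣ ≟ 2) ps

-- The given `Λ` guarantees that there is a family of this size at all; for a size above the number
-- of pairs there would be no maximum to attain.
maximum-exists : (Λ : Family m) → ∃[ k ] IsKᵣ m (Family.size Λ) k
maximum-exists {m} Λ = K Λ* , (Λ* , length-toList v* , refl) , maximal
  where
  r = Family.size Λ

  valid? : Decidable (λ (v : Vec (Subset m) r) → IsFamily (toList v))
  valid? v = isFamily? (toList v)

  value : Vec (Subset m) r → ℕ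
  value v = intersections (toList v)

  -- The default of `argmax`. It must itself be a family, since `argmax` may return it.
  v₀ : Vec (Subset m) r
  v₀ = fromList (Family.members Λ)

  candidates : List (Vec (Subset m) r)
  candidates = filter valid? (vectors (subsets m) r)

  v* : Vec (Subset m) r
  v* = argmax value v₀ candidates

  isFamily* : IsFamily (toList v*)
  isFamily* = argmax-all value {P = λ v → IsFamily (toList v)}
    (subst IsFamily (sym (toList∘fromList (Family.members Λ))) (Family.distinct Λ , Family.pairs Λ))
    (all-filter valid? (vectors (subsets m) r))

  Λ* : Family m
  Λ* = record { members = toList v* ; distinct = proj₁ isFamily* ; pairs = proj₂ isFamily* }

  maximal : (Λ′ : Family m) → Family.size Λ′ ≡ r → K Λ′ ≤ K Λ*
  -- A competitor of size `r` is the list of some vector of length `r`, so it appears among the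
  -- candidates.
  maximal Λ′ ∣Λ′∣≡r with v , v≡Λ′ ← toList-surjective (Family.members Λ′) ∣Λ′∣≡r =
    subst (λ ps → intersections ps ≤ K Λ*) v≡Λ′
      (All.lookup (f[xs]≤f[argmax] v₀ candidates)
        (∈-filter⁺ valid? (∈-vectors ∈-subsets v)
          (subst IsFamily (sym v≡Λ′) (Family.distinct Λ′ , Family.pairs Λ′))))

proposition14 : (m : ℕ) → 2 ≤ m → (r : ℕ) (Λ : Family m) → Family.size Λ ≡ r →
    (toℚ (K Λ) ≡ (½ *ℚ toℚ (Σdeg² G⟨ Λ ⟩)) -ℚ toℚ r)
    × (Σdeg² G⟨ Λ ⟩ ≡ 2 * K Λ + 2 * r)
    × (Subclose Λ ⇔ Optimal G⟨ Λ ⟩)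
    × ∃₂ (λ s k → IsMaxΣdeg² m r s × IsKᵣ m r k × s ≡ 2 * k + 2 * r)
proposition14 m _ r Λ refl =
  subst (λ s → toℚ (K Λ) ≡ (½ *ℚ toℚ s) -ℚ toℚ r) (sym Σ≡) (halve (K Λ) r) ,
  Σ≡ ,
  -- `Optimal` is maximality of the value `Σdeg² G⟨ Λ ⟩`; replacing it through `Σ≡` gives the
  -- transfer at `k = K Λ`.
  subst (λ s → Subclose Λ ⇔ IsMaxΣdeg² m r s) (sym Σ≡) IsKᵣ⇔IsMaxΣdeg² ,
  let k , isKᵣ = maximum-exists Λ in
  2 * k + 2 * r , k , Equivalence.to IsKᵣ⇔IsMaxΣdeg² isKᵣ , isKᵣ , refl
  where
  Σ≡ = Σdeg²≡2K+2r Λ
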